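{- Let $p\ge 3$ be an integer, let $x$ be a right vertex of $T_H$, and let $f$ be any $2p$ distance coloring of $T_H$. Then there exists a vertex $u\in\mathcal{F}_{x,p+1}$ such that $f(u)\notin f(V(D_x^{2p}))$.
   Context: $T_H$ is the infinite hexagonal grid with vertex set $\mathbb{Z}^2$: $(i,j)$ is adjacent to $(i,j\pm1)$, and $(i,j)$ is adjacent to $(i+1,j)$ iff $i+j$ is even; no other edges. A vertex $(i,j)$ with $i+j$ even is called a right vertex. $d(u,v)$ is graph distance. For $l\in\mathbb{N}$, an $l$ distance coloring is a map $f:V(T_H)\to\{1,\dots,n\}$ with $f(u)\ne f(v)$ for all distinct $u,v$ with $d(u,v)\le l$. For a vertex $x$ and integer $k\ge0$, $\mathcal{F}_{x,k}=\{u\in V(T_H): d(x,u)=k\}$. $D_x^{2p}$ is the subgraph of $T_H$ induced by $\{w: d(w,x)\le p\}$. -}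

module Defs where

open import Data.Fin.Base using (Fin)
open import Data.Integer.Base using (ℤ; +_; _+_) renaming (suc to sucℤ)
open import Data.Integer.Divisibility using (_∣_)
open import Data.Nat.Base using (ℕ; zero; suc; _≤_)
open import Data.Product.Base using (∃-syntax; _×_; _,_)
open import Level using (0ℓ)
open import Relation.Binary.Construct.Closure.ReflexiveTransitive using (Star; ε; _◅_)
open import Relation.Binary.Construct.Closure.Symmetric using (SymClosure; symmetric)
open import Relation.Binary.Core using (Rel; _⇒_)
open import Relation.Binary.Definitions using (Symmetric)
open import Relation.Binary.PropositionalEquality.Core using (_≡_; _≢_)
open import Relation.Unary using (Pred; _∈_)

Vertex : Set
Vertex = ℤ × ℤ

Right : Pred Vertex 0ℓ
Right (i , j) = + 2 ∣ i + j

-- Each undirected edge is listed once, in the direction of the increasing coordinate.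
data Edge : Rel Vertex 0ℓ where
  vertical   : ∀ {i j} → Edge (i , j) (i , sucℤ j)
  horizontal : ∀ {i j} → Right (i , j) → Edge (i , j) (sucℤ i , j)

Adjacent : Rel Vertex 0ℓ
Adjacent = SymClosure Edge

Walk : Rel Vertex 0ℓ
Walk = Star Adjacent

length : ∀ {u v} → Walk u v → ℕ
length ε       = zero
length (_ ◅ w) = suc (length w)

-- d[ u , v ]≡ k : the graph distance from u to v is k.
d[_,_]≡_ : Vertex → Vertex → ℕ → Set
d[ u , v ]≡ k = (∃[ w ] length {u} {v} w ≡ k) × (∀ (w : Walk u v) → k ≤ length w)

d[_,_]≤_ : Vertex → Vertex → ℕ → Set
d[ u , v ]≤ l = ∃[ k ] (d[ u , v ]≡ k × k ≤ l)

-- Fin n stands for the set of colors {1,…,n}.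
IsDistanceColoring : ∀ {n} → ℕ → (Vertex → Fin n) → Set
IsDistanceColoring l f = ∀ u v → u ≢ v → d[ u , v ]≤ l → f u ≢ f v

𝓕 : Vertex → ℕ → Pred Vertex 0ℓ
𝓕 x k u = d[ x , u ]≡ k

record Subgraph : Set₁ where
  field
    V          : Pred Vertex 0ℓ
    E          : Rel Vertex 0ℓ
    E-sym      : Symmetric E
    E⇒adjacent : E ⇒ Adjacent
    E⇒source∈V : ∀ {u v} → E u v → u ∈ V
    E⇒target∈V : ∀ {u v} → E u v → v ∈ V

open Subgraph public using (V)

induced : Pred Vertex 0ℓ → Subgraph
induced S = record
  { V          = S
  ; E          = λ u v → u ∈ S × v ∈ S × Adjacent u v
  ; E-sym      = λ (p , q , a) → q , p , symmetric Edge a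
  ; E⇒adjacent = λ (_ , _ , a) → a
  ; E⇒source∈V = λ (p , _ , _) → p
  ; E⇒target∈V = λ (_ , q , _) → q
  }

-- D^2 p x is the graph D_x^{2p}: the superscript 2p is a diameter, the radius is p.
D^2 : ℕ → Vertex → Subgraph
D^2 p x = induced (λ w → d[ w , x ]≤ p)

-- The direct image f(S).
image : ∀ {n} → (Vertex → Fin n) → Pred Vertex 0ℓ → Pred (Fin n) 0ℓ
image f S c = ∃[ w ] (w ∈ S × f w ≡ c)

{-# OPTIONS --safe #-}
module Submission where

-- In coordinates (a , b , c) around x with a + b + c ∈ {0 , 1}, graph distance is the ℓ₁ distance.
-- If every u at distance p + 1 shares its color with some w in the ball, then d(u , w) = 2p + 1, so w lies
-- at distance p and u, w have opposite signs in each coordinate. When u and u′ share their color they share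
-- such a w, and u, u′, w are pairwise opposite in every coordinate; each has both a positive and a negative
-- coordinate, so each has exactly one zero coordinate. There are six such u, forming two orbits under
-- cyclic rotation of the coordinates; u and u′ lie in the same orbit, and no w is opposite to a whole orbit.
-- Dropping at most one vertex per orbit thus leaves at least 3(p + 1) − 2 distinct colors on the outer
-- sphere, all of them occurring among the 3p vertices at distance p: a contradiction.

open import Defs
import Algebra.Properties.AbelianGroup as AbelianGroupProperties
open import Data.Bool.Base using (Bool; true; false; T; _∧_)
open import Data.Bool.Properties using (T?; T-∧)
open import Data.Empty using (⊥; ⊥-elim)
open import Data.Fin.Base using (Fin; zero; suc; toℕ; fromℕ<; opposite)
open import Data.Fin.Patterns using (0F; 1F; 2F; 3F)
import Data.Fin.Properties as Fin
open import Data.Integer.Base as ℤ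
  using (ℤ; +_; +0; +[1+_]; -[1+_]; 0ℤ; 1ℤ; ∣_∣; _-_; -_; +≤+) renaming (suc to sucℤ; pred to predℤ)
import Data.Integer.Divisibility.Signed as Signed
import Data.Integer.Properties as ℤ
import Data.Integer.Tactic.RingSolver as ℤ-Solver
open import Data.Nat.Base as ℕ using (ℕ; zero; suc; _≤_; _+_; _*_; z≤n; s≤s; ⌊_/2⌋)
open import Data.Nat.Divisibility using (_∣?_)
import Data.Nat.Properties as ℕ
import Data.Nat.Tactic.RingSolver as ℕ-Solver
open import Data.Product.Base using (∃-syntax; _×_; _,_; proj₁; proj₂)
open import Data.Product.Function.NonDependent.Propositional using (_×-↔_)
open import Data.Product.Properties using (≡-dec)
open import Data.Sum.Base as Sum using (_⊎_; inj₁; inj₂)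
open import Function.Base using (_∘_)
open import Function.Bundles using (_↔_; Equivalence; Inverse)
open import Function.Construct.Composition using (_↔-∘_)
open import Function.Construct.Identity using (↔-id)
open import Relation.Binary.Construct.Closure.ReflexiveTransitive using (ε; _◅_)
open import Relation.Binary.Construct.Closure.Symmetric using (fwd; bwd; symmetric)
open import Relation.Binary.PropositionalEquality
open import Relation.Nullary using (¬_; Dec; yes; no)
open import Relation.Nullary.Decidable using (from-yes; from-no; ¬?; _→-dec_; _×-dec_; _⊎-dec_)
open import Relation.Nullary.Negation using (contradiction)
open import Relation.Unary using (_∈_; _∉_)

open AbelianGroupProperties ℤ.+-0-abelianGroup using () renaming (∙-cancelˡ to +-cancelˡ; ∙-cancelʳ to +-cancelʳ)

-- Ring identities

-- Without abstract, Agda's injectivity analysis unfolds the proof terms of the ring solver.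
abstract
  interleave : ∀ a b c a′ b′ c′ → a′ + a + (b′ + b) + (c′ + c) ≡ a + b + c + (a′ + b′ + c′)
  interleave = ℕ-Solver.solve-∀

  double : ∀ i → i ℤ.+ i ≡ i ℤ.* + 2
  double = ℤ-Solver.solve-∀

  total-suc₁ : ∀ a b c → 1ℤ ℤ.+ a ℤ.+ b ℤ.+ c ≡ 1ℤ ℤ.+ (a ℤ.+ b ℤ.+ c)
  total-suc₁ = ℤ-Solver.solve-∀

  total-suc₂ : ∀ a b c → a ℤ.+ (1ℤ ℤ.+ b) ℤ.+ c ≡ 1ℤ ℤ.+ (a ℤ.+ b ℤ.+ c)
  total-suc₂ = ℤ-Solver.solve-∀

  total-suc₃ : ∀ a b c → a ℤ.+ b ℤ.+ (1ℤ ℤ.+ c) ≡ 1ℤ ℤ.+ (a ℤ.+ b ℤ.+ c)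
  total-suc₃ = ℤ-Solver.solve-∀

  total-minus : ∀ a b c a′ b′ c′ → (a - a′) ℤ.+ (b - b′) ℤ.+ (c - c′) ≡ (a ℤ.+ b ℤ.+ c) - (a′ ℤ.+ b′ ℤ.+ c′)
  total-minus = ℤ-Solver.solve-∀

  minus-suc : ∀ i j → i - (1ℤ ℤ.+ j) ≡ ℤ.- 1ℤ ℤ.+ (i - j)
  minus-suc = ℤ-Solver.solve-∀

  suc-minus-suc : ∀ i j → i - j ≡ 1ℤ ℤ.+ (i - (1ℤ ℤ.+ j))
  suc-minus-suc = ℤ-Solver.solve-∀

  pred-minus : ∀ i j → (ℤ.- 1ℤ ℤ.+ j) - i ≡ ℤ.- 1ℤ ℤ.+ (j - i)
  pred-minus = ℤ-Solver.solve-∀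

  plus-suc : ∀ x a → x ℤ.+ (1ℤ ℤ.+ a) ≡ 1ℤ ℤ.+ (x ℤ.+ a)
  plus-suc = ℤ-Solver.solve-∀

  plus-suc-minus : ∀ x b c → x ℤ.+ (1ℤ ℤ.+ b - c) ≡ 1ℤ ℤ.+ (x ℤ.+ (b - c))
  plus-suc-minus = ℤ-Solver.solve-∀

  plus-minus-suc : ∀ x b c → x ℤ.+ (b - c) ≡ 1ℤ ℤ.+ (x ℤ.+ (b - (1ℤ ℤ.+ c)))
  plus-minus-suc = ℤ-Solver.solve-∀

  place-parity : ∀ x y a b c →
    (x ℤ.+ a) ℤ.+ (y ℤ.+ (b - c)) ≡ (x ℤ.+ y) ℤ.+ (a ℤ.+ b ℤ.+ c ℤ.+ (ℤ.- c) ℤ.* + 2)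
  place-parity = ℤ-Solver.solve-∀

  recover-double : ∀ a b c → (a ℤ.+ b ℤ.+ c) ℤ.+ (b - c) - a ≡ b ℤ.+ b
  recover-double = ℤ-Solver.solve-∀

  odd-difference : ∀ b b′ → 1ℤ ℤ.+ ((b - b′) ℤ.+ (b - b′)) ≡ 1ℤ ℤ.+ (b ℤ.+ b) - (b′ ℤ.+ b′)
  odd-difference = ℤ-Solver.solve-∀

  suc-zero-plus : ∀ x a → 1ℤ ℤ.+ (0ℤ ℤ.+ x - a) ≡ 1ℤ ℤ.+ x - a
  suc-zero-plus = ℤ-Solver.solve-∀

  total-plus : ∀ a b c a′ b′ c′ → (a ℤ.+ b ℤ.+ c) ℤ.+ (a′ ℤ.+ b′ ℤ.+ c′) ≡ (a ℤ.+ a′) ℤ.+ (b ℤ.+ b′) ℤ.+ (c ℤ.+ c′)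
  total-plus = ℤ-Solver.solve-∀

  sphere-sizes : ∀ α β → 3 * (suc α + suc (suc β)) ≡ 3 + 3 * (suc β + suc α)
  sphere-sizes = ℕ-Solver.solve-∀

  outer-radius : ∀ α β → suc (suc β) + suc α ≡ suc α + suc β + 1
  outer-radius = ℕ-Solver.solve-∀

  outer+inner : ∀ α β → suc (suc β) + suc α + (suc α + suc β) ≡ suc (2 * (suc α + suc β))
  outer+inner = ℕ-Solver.solve-∀

  outer+outer : ∀ α β → suc (suc β) + suc α + (suc (suc β) + suc α) ≡ suc (suc (2 * (suc α + suc β)))
  outer+outer = ℕ-Solver.solve-∀

-- Coordinate triples and the ℓ₁ distance

Triple : Set → Set
Triple A = A × A × A

Coords : Set
Coords = Triple ℤ

origin : Coords
origin = 0ℤ , 0ℤ , 0ℤ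

total : Coords → ℤ
total (a , b , c) = a ℤ.+ b ℤ.+ c

-- Two consecutive layers of the cubic lattice: total 0 will be the right vertices, total 1 the
-- others.
Valid : Coords → Set
Valid t = total t ≡ 0ℤ ⊎ total t ≡ 1ℤ

∥_∥ : Coords → ℕ
∥ a , b , c ∥ = ∣ a ∣ + ∣ b ∣ + ∣ c ∣

_⊟_ : Coords → Coords → Coords
(a , b , c) ⊟ (a′ , b′ , c′) = a - a′ , b - b′ , c - c′

dist : Coords → Coords → ℕ
dist s t = ∥ t ⊟ s ∥

dist-sym : ∀ s t → dist s t ≡ dist t s
dist-sym (a , b , c) (a′ , b′ , c′) =
  cong₂ _+_ (cong₂ _+_ (ℤ.∣i-j∣≡∣j-i∣ a′ a) (ℤ.∣i-j∣≡∣j-i∣ b′ b)) (ℤ.∣i-j∣≡∣j-i∣ c′ c)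

dist-origin : ∀ t → dist origin t ≡ ∥ t ∥
dist-origin (a , b , c) =
  cong₂ _+_ (cong₂ _+_ (cong ∣_∣ (ℤ.+-identityʳ a)) (cong ∣_∣ (ℤ.+-identityʳ b))) (cong ∣_∣ (ℤ.+-identityʳ c))

dist-self : ∀ t → dist t t ≡ 0
dist-self (a , b , c) rewrite ℤ.+-inverseʳ a | ℤ.+-inverseʳ b | ℤ.+-inverseʳ c = refl

dist≤∥∥+∥∥ : ∀ s t → dist s t ≤ ∥ s ∥ + ∥ t ∥
dist≤∥∥+∥∥ (a , b , c) (a′ , b′ , c′) = begin
  ∣ a′ - a ∣ + ∣ b′ - b ∣ + ∣ c′ - c ∣
    ≤⟨ ℕ.+-mono-≤ (ℕ.+-mono-≤ (ℤ.∣i-j∣≤∣i∣+∣j∣ a′ a) (ℤ.∣i-j∣≤∣i∣+∣j∣ b′ b)) (ℤ.∣i-j∣≤∣i∣+∣j∣ c′ c) ⟩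
  ∣ a′ ∣ + ∣ a ∣ + (∣ b′ ∣ + ∣ b ∣) + (∣ c′ ∣ + ∣ c ∣)
    ≡⟨ interleave (∣ a ∣) (∣ b ∣) (∣ c ∣) (∣ a′ ∣) (∣ b′ ∣) (∣ c′ ∣) ⟩
  ∣ a ∣ + ∣ b ∣ + ∣ c ∣ + (∣ a′ ∣ + ∣ b′ ∣ + ∣ c′ ∣) ∎
  where open ℕ.≤-Reasoning

odd : ∀ z → ¬ (1ℤ ℤ.+ (z ℤ.+ z) ≡ 0ℤ)
odd z eq = from-no (2 ∣? 1) (Signed.∣⇒∣ᵤ
  (Signed.∣m+n∣n⇒∣m {+ 2} {1ℤ} {z ℤ.+ z} (subst (+ 2 Signed.∣_) (sym eq) (Signed.divides 0ℤ refl)) (Signed.divides z (double z))))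

infix 4 _↗_
data _↗_ : Coords → Coords → Set where
  ↗₁ : ∀ {a b c} → (a , b , c) ↗ (sucℤ a , b , c)
  ↗₂ : ∀ {a b c} → (a , b , c) ↗ (a , sucℤ b , c)
  ↗₃ : ∀ {a b c} → (a , b , c) ↗ (a , b , sucℤ c)

total-↗ : ∀ {s t} → s ↗ t → total t ≡ 1ℤ ℤ.+ total s
total-↗ {a , b , c} ↗₁ = total-suc₁ a b c
total-↗ {a , b , c} ↗₂ = total-suc₂ a b c
total-↗ {a , b , c} ↗₃ = total-suc₃ a b c

↙₁ : ∀ a b c → (predℤ a , b , c) ↗ (a , b , c)
↙₁ a b c = subst (λ z → (predℤ a , b , c) ↗ (z , b , c)) (ℤ.suc-pred a) ↗₁

↙₂ : ∀ a b c → (a , predℤ b , c) ↗ (a , b , c)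
↙₂ a b c = subst (λ z → (a , predℤ b , c) ↗ (a , z , c)) (ℤ.suc-pred b) ↗₂

↙₃ : ∀ a b c → (a , b , predℤ c) ↗ (a , b , c)
↙₃ a b c = subst (λ z → (a , b , predℤ c) ↗ (a , b , z)) (ℤ.suc-pred c) ↗₃

sucℤ-injective : ∀ {i j} → sucℤ i ≡ sucℤ j → i ≡ j
sucℤ-injective {i} {j} = +-cancelˡ 1ℤ i j

↗-total≡0 : ∀ {s t} → s ↗ t → total t ≡ 1ℤ → total s ≡ 0ℤ
↗-total≡0 s↗t t≡1 = sucℤ-injective (trans (sym (total-↗ s↗t)) t≡1)

↗-total≡1 : ∀ {s t} → s ↗ t → total s ≡ 0ℤ → total t ≡ 1ℤ
↗-total≡1 s↗t s≡0 = trans (total-↗ s↗t) (cong sucℤ s≡0)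

∣i-j∣≤ : ∀ i j → ∣ i - j ∣ ≤ suc ∣ i - sucℤ j ∣
∣i-j∣≤ i j = subst (λ z → ∣ z ∣ ≤ suc ∣ i - sucℤ j ∣) (sym (suc-minus-suc i j)) (ℤ.∣i+j∣≤∣i∣+∣j∣ 1ℤ (i - sucℤ j))

∣i-sucj∣≤ : ∀ i j → ∣ i - sucℤ j ∣ ≤ suc ∣ i - j ∣
∣i-sucj∣≤ i j = subst (λ z → ∣ z ∣ ≤ suc ∣ i - j ∣) (sym (minus-suc i j)) (ℤ.∣i+j∣≤∣i∣+∣j∣ (ℤ.- 1ℤ) (i - j))

module _ {i j k : ℕ} where
  bump₁ : ∀ {i′} → i′ ≤ suc i → i′ + j + k ≤ suc (i + j + k)
  bump₁ h = ℕ.+-monoˡ-≤ k (ℕ.+-monoˡ-≤ j h)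

  bump₂ : ∀ {j′} → j′ ≤ suc j → i + j′ + k ≤ suc (i + j + k)
  bump₂ h = ℕ.≤-trans (ℕ.+-monoˡ-≤ k (ℕ.+-monoʳ-≤ i h)) (ℕ.≤-reflexive (cong (_+ k) (ℕ.+-suc i j)))

  bump₃ : ∀ {k′} → k′ ≤ suc k → i + j + k′ ≤ suc (i + j + k)
  bump₃ h = ℕ.≤-trans (ℕ.+-monoʳ-≤ (i + j) h) (ℕ.≤-reflexive (ℕ.+-suc (i + j) k))

  drop₁ : ∀ {i′} → suc i′ ≡ i → suc (i′ + j + k) ≡ i + j + k
  drop₁ refl = refl

  drop₂ : ∀ {j′} → suc j′ ≡ j → suc (i + j′ + k) ≡ i + j + k
  drop₂ refl = cong (_+ k) (sym (ℕ.+-suc i _))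

  drop₃ : ∀ {k′} → suc k′ ≡ k → suc (i + j + k′) ≡ i + j + k
  drop₃ refl = sym (ℕ.+-suc (i + j) _)

dist-↗ : ∀ {s t} r → s ↗ t → dist s r ≤ suc (dist t r)
dist-↗ {a , b , c} (a′ , b′ , c′) ↗₁ = bump₁ (∣i-j∣≤ a′ a)
dist-↗ {a , b , c} (a′ , b′ , c′) ↗₂ = bump₂ {∣ a′ - a ∣} (∣i-j∣≤ b′ b)
dist-↗ {a , b , c} (a′ , b′ , c′) ↗₃ = bump₃ {∣ a′ - a ∣} {∣ b′ - b ∣} (∣i-j∣≤ c′ c)

dist-↙ : ∀ {s t} r → s ↗ t → dist t r ≤ suc (dist s r)
dist-↙ {a , b , c} (a′ , b′ , c′) ↗₁ = bump₁ (∣i-sucj∣≤ a′ a)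
dist-↙ {a , b , c} (a′ , b′ , c′) ↗₂ = bump₂ {∣ a′ - a ∣} (∣i-sucj∣≤ b′ b)
dist-↙ {a , b , c} (a′ , b′ , c′) ↗₃ = bump₃ {∣ a′ - a ∣} {∣ b′ - b ∣} (∣i-sucj∣≤ c′ c)

-- Applied to the difference of two triples: a positive entry names a coordinate in which a unit
-- step shortens the distance, and without one the triples coincide.
positive-or-zero : ∀ i j k → 0ℤ ℤ.≤ i ℤ.+ j ℤ.+ k →
  (∃[ n ] i ≡ +[1+ n ]) ⊎ (∃[ n ] j ≡ +[1+ n ]) ⊎ (∃[ n ] k ≡ +[1+ n ]) ⊎ (i ≡ 0ℤ × j ≡ 0ℤ × k ≡ 0ℤ)
positive-or-zero +[1+ n ] _ _ _ = inj₁ (n , refl)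
positive-or-zero _ +[1+ n ] _ _ = inj₂ (inj₁ (n , refl))
positive-or-zero _ _ +[1+ n ] _ = inj₂ (inj₂ (inj₁ (n , refl)))
positive-or-zero +0 +0 +0 _ = inj₂ (inj₂ (inj₂ (refl , refl , refl)))
positive-or-zero +0 +0 -[1+ _ ] ()
positive-or-zero +0 -[1+ _ ] +0 ()
positive-or-zero +0 -[1+ _ ] -[1+ _ ] ()
positive-or-zero -[1+ _ ] +0 +0 ()
positive-or-zero -[1+ _ ] +0 -[1+ _ ] ()
positive-or-zero -[1+ _ ] -[1+ _ ] +0 ()
positive-or-zero -[1+ _ ] -[1+ _ ] -[1+ _ ] ()

∣i-suc∣ : ∀ {i j n} → i - j ≡ +[1+ n ] → suc ∣ i - sucℤ j ∣ ≡ ∣ i - j ∣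
∣i-suc∣ {i} {j} eq rewrite minus-suc i j | eq = refl

∣i-pred∣ : ∀ {i j n} → j - i ≡ +[1+ n ] → suc ∣ i - predℤ j ∣ ≡ ∣ i - j ∣
∣i-pred∣ {i} {j} eq = trans (cong suc (trans (ℤ.∣i-j∣≡∣j-i∣ i (predℤ j)) (cong ∣_∣ (trans (pred-minus i j) (cong predℤ eq)))))
  (trans (sym (cong ∣_∣ eq)) (ℤ.∣i-j∣≡∣j-i∣ j i))

total-⊟ : ∀ s t → total (s ⊟ t) ≡ total s - total t
total-⊟ (a , b , c) (a′ , b′ , c′) = total-minus a b c a′ b′ c′

⊟-zero : ∀ {a b c a′ b′ c′} → a - a′ ≡ 0ℤ → b - b′ ≡ 0ℤ → c - c′ ≡ 0ℤ → (a , b , c) ≡ (a′ , b′ , c′)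
⊟-zero p q r = cong₂ _,_ (ℤ.i-j≡0⇒i≡j _ _ p) (cong₂ _,_ (ℤ.i-j≡0⇒i≡j _ _ q) (ℤ.i-j≡0⇒i≡j _ _ r))

-- A triple of total 0 lies in the lower layer, so only upward steps leave it, and a difference of
-- nonnegative total ensures that one of them leads toward `t`. The upper layer is symmetric.
total-nonNeg-from-even : ∀ s t → total s ≡ 0ℤ → Valid t → 0ℤ ℤ.≤ total (t ⊟ s)
total-nonNeg-from-even s t p (inj₁ q) rewrite total-⊟ t s | p | q = +≤+ z≤n
total-nonNeg-from-even s t p (inj₂ q) rewrite total-⊟ t s | p | q = +≤+ z≤n

total-nonNeg-from-odd : ∀ s t → total s ≡ 1ℤ → Valid t → 0ℤ ℤ.≤ total (s ⊟ t)
total-nonNeg-from-odd s t p (inj₁ q) rewrite total-⊟ s t | p | q = +≤+ z≤n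
total-nonNeg-from-odd s t p (inj₂ q) rewrite total-⊟ s t | p | q = +≤+ z≤n

-- Coordinates on the grid: graph distance is ℓ₁ distance

module Embedding (x : Vertex) (x-right : Right x) where

  x₁ x₂ : ℤ
  x₁ = proj₁ x
  x₂ = proj₂ x

  -- The three neighbors of place t arise by adding 1 to a coordinate if total t ≡ 0ℤ, by subtracting 1 otherwise.
  place : Coords → Vertex
  place (a , b , c) = x₁ ℤ.+ a , x₂ ℤ.+ (b - c)

  vertical′ : ∀ {i j j′} → j′ ≡ sucℤ j → Edge (i , j) (i , j′)
  vertical′ refl = vertical

  horizontal′ : ∀ {i i′ j} → i′ ≡ sucℤ i → Right (i , j) → Edge (i , j) (i′ , j)
  horizontal′ refl = horizontal

  -- The two entries of `place t` add up to `total t` plus the even numbers `x₁ + x₂` and `- 2c`, so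
  -- the layer decides the parity.
  place-right : ∀ t → total t ≡ 0ℤ → Right (place t)
  place-right t@(a , b , c) t≡0 = Signed.∣⇒∣ᵤ (subst (+ 2 Signed.∣_) (sym (place-parity x₁ x₂ a b c))
    (Signed.∣m∣n⇒∣m+n {+ 2} {x₁ ℤ.+ x₂} (Signed.∣ᵤ⇒∣ x-right)
      (subst (λ z → + 2 Signed.∣ z ℤ.+ (ℤ.- c) ℤ.* + 2) (sym t≡0) (Signed.divides (ℤ.- c) (ℤ.+-identityˡ _)))))

  place-¬right : ∀ t → total t ≡ 1ℤ → ¬ Right (place t)
  place-¬right t@(a , b , c) t≡1 r = from-no (2 ∣? 1) (Signed.∣⇒∣ᵤ
    (Signed.∣m+n∣n⇒∣m {+ 2} {1ℤ} {(ℤ.- c) ℤ.* + 2}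
      (subst (λ z → + 2 Signed.∣ z ℤ.+ (ℤ.- c) ℤ.* + 2) t≡1
        (Signed.∣m+n∣m⇒∣n {+ 2} {x₁ ℤ.+ x₂} (subst (+ 2 Signed.∣_) (place-parity x₁ x₂ a b c) (Signed.∣ᵤ⇒∣ r)) (Signed.∣ᵤ⇒∣ x-right)))
      (Signed.divides (ℤ.- c) refl)))

  right-suc : ∀ i j → Right (i , j) → ¬ Right (sucℤ i , j)
  right-suc i j r r′ = from-no (2 ∣? 1) (Signed.∣⇒∣ᵤ
    (Signed.∣m+n∣n⇒∣m {+ 2} {1ℤ} {i ℤ.+ j} (subst (+ 2 Signed.∣_) (ℤ.+-assoc 1ℤ i j) (Signed.∣ᵤ⇒∣ r′)) (Signed.∣ᵤ⇒∣ r)))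

  ↗-adjacent : ∀ {s t} → total s ≡ 0ℤ → s ↗ t → Adjacent (place s) (place t)
  ↗-adjacent {s@(a , b , c)} s≡0 ↗₁ = fwd (horizontal′ (plus-suc x₁ a) (place-right s s≡0))
  ↗-adjacent {s@(a , b , c)} s≡0 ↗₂ = fwd (vertical′ (plus-suc-minus x₂ b c))
  ↗-adjacent {s@(a , b , c)} s≡0 ↗₃ = bwd (vertical′ (plus-minus-suc x₂ b c))

  -- Each kind and direction of edge at `place t` moves one particular coordinate; a horizontal edge
  -- in the wrong direction is excluded by parity.
  lift : ∀ {v} t → Valid t → Adjacent v (place t) →
         ∃[ s ] (Valid s × place s ≡ v × (s ↗ t ⊎ t ↗ s))
  lift {i , j} t@(a , b , c) (inj₁ t≡0) (fwd e) = go e refl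
    where
    -- The far endpoint becomes a variable with an equation, because `sucℤ j` does not unify with
    -- the second entry of `place t`.
    go : ∀ {u} → Edge (i , j) u → u ≡ place t → ∃[ s ] (Valid s × place s ≡ (i , j) × (s ↗ t ⊎ t ↗ s))
    go vertical eq = _ , inj₂ (↗-total≡1 {t} ↗₃ t≡0) ,
      cong₂ _,_ (sym (cong proj₁ eq))
        (sucℤ-injective (trans (sym (plus-minus-suc x₂ b c)) (sym (cong proj₂ eq)))) , inj₂ ↗₃
    go (horizontal r) eq = contradiction (subst Right (sym eq) (place-right t t≡0)) (right-suc i j r)
  lift {i , j} t@(a , b , c) (inj₂ t≡1) (fwd e) = go e refl
    where
    go : ∀ {u} → Edge (i , j) u → u ≡ place t → ∃[ s ] (Valid s × place s ≡ (i , j) × (s ↗ t ⊎ t ↗ s))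
    go vertical eq = _ , inj₁ (↗-total≡0 (↙₂ a b c) t≡1) ,
      cong₂ _,_ (sym (cong proj₁ eq))
        (sucℤ-injective (trans (sym (plus-suc-minus x₂ (predℤ b) c))
          (trans (cong (λ z → x₂ ℤ.+ (z - c)) (ℤ.suc-pred b)) (sym (cong proj₂ eq))))) , inj₁ (↙₂ a b c)
    go (horizontal r) eq = _ , inj₁ (↗-total≡0 (↙₁ a b c) t≡1) ,
      cong₂ _,_
        (sucℤ-injective (trans (sym (plus-suc x₁ (predℤ a)))
          (trans (cong (λ z → x₁ ℤ.+ z) (ℤ.suc-pred a)) (sym (cong proj₁ eq)))))
        (sym (cong proj₂ eq)) , inj₁ (↙₁ a b c)
  lift t@(a , b , c) (inj₁ t≡0) (bwd vertical) =
    _ , inj₂ (↗-total≡1 {t} ↗₂ t≡0) , cong (_ ,_) (plus-suc-minus x₂ b c) , inj₂ ↗₂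
  lift t@(a , b , c) (inj₁ t≡0) (bwd (horizontal r)) =
    _ , inj₂ (↗-total≡1 {t} ↗₁ t≡0) , cong (_, _) (plus-suc x₁ a) , inj₂ ↗₁
  lift t@(a , b , c) (inj₂ t≡1) (bwd vertical) = _ , inj₁ (↗-total≡0 (↙₃ a b c) t≡1) ,
    cong (_ ,_) (trans (plus-minus-suc x₂ b (predℤ c)) (cong (λ z → sucℤ (x₂ ℤ.+ (b - z))) (ℤ.suc-pred c))) ,
    inj₁ (↙₃ a b c)
  lift t@(a , b , c) (inj₂ t≡1) (bwd (horizontal r)) = contradiction r (place-¬right t t≡1)

  lift-dist : ∀ {s t} r → s ↗ t ⊎ t ↗ s → dist s r ≤ suc (dist t r)
  lift-dist r (inj₁ s↗t) = dist-↗ r s↗t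
  lift-dist r (inj₂ t↗s) = dist-↙ r t↗s

  -- Lifting the walk backward from its end changes the ℓ₁ distance by at most one per edge. This
  -- also provides coordinates for any vertex joined to `place t`.
  walk-coords : ∀ {u t} → Valid t → (w : Walk u (place t)) →
                ∃[ s ] (Valid s × place s ≡ u × dist s t ≤ length w)
  walk-coords {t = t} t-valid ε = t , t-valid , refl , ℕ.≤-reflexive (dist-self t)
  walk-coords {t = t} t-valid (e ◅ w) with walk-coords t-valid w
  ... | s , s-valid , refl , s≤ with lift s s-valid e
  ... | r , r-valid , eq , step = r , r-valid , eq , ℕ.≤-trans (lift-dist t step) (s≤s s≤)

  -- The vertex determines `a` and `b - c`, and with the total these determine `2b`. Different
  -- totals would make two even numbers differ by one.
  place-injective : ∀ {s t} → Valid s → Valid t → place s ≡ place t → s ≡ t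
  place-injective {a , b , c} {a′ , b′ , c′} s-valid t-valid eq = go s-valid t-valid
    where
    a≡ : a ≡ a′
    a≡ = +-cancelˡ x₁ a a′ (cong proj₁ eq)
    b-c≡ : b - c ≡ b′ - c′
    b-c≡ = +-cancelˡ x₂ (b - c) (b′ - c′) (cong proj₂ eq)
    doubles : ∀ {m n} → total (a , b , c) ≡ m → total (a′ , b′ , c′) ≡ n →
              m ℤ.+ (b - c) - a ≡ b ℤ.+ b × n ℤ.+ (b - c) - a ≡ b′ ℤ.+ b′
    doubles refl refl = recover-double a b c ,
      trans (cong₂ (λ x y → total (a′ , b′ , c′) ℤ.+ x - y) b-c≡ a≡) (recover-double a′ b′ c′)
    halve : ∀ {i j} → i ℤ.+ i ≡ j ℤ.+ j → i ≡ j
    halve {i} {j} h = ℤ.*-cancelʳ-≡ i j (+ 2) (trans (sym (double i)) (trans h (double j)))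
    same : ∀ {m} → total (a , b , c) ≡ m → total (a′ , b′ , c′) ≡ m → (a , b , c) ≡ (a′ , b′ , c′)
    same p q with doubles p q
    ... | e , e′ = cong₂ _,_ a≡ (cong₂ _,_ b≡
          (ℤ.neg-injective (+-cancelˡ b (- c) (- c′) (trans b-c≡ (cong (_- c′) (sym b≡))))))
      where
      b≡ : b ≡ b′
      b≡ = halve (trans (sym e) e′)
    differ : ∀ m b b′ → m ≡ b ℤ.+ b → 1ℤ ℤ.+ m ≡ b′ ℤ.+ b′ → ⊥
    differ m b b′ e e′ = odd (b - b′) (trans (odd-difference b b′)
      (trans (cong (λ z → 1ℤ ℤ.+ z - (b′ ℤ.+ b′)) (sym e)) (ℤ.i≡j⇒i-j≡0 e′)))
    go : Valid (a , b , c) → Valid (a′ , b′ , c′) → (a , b , c) ≡ (a′ , b′ , c′)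
    go (inj₁ p) (inj₁ q) = same p q
    go (inj₂ p) (inj₂ q) = same p q
    go (inj₁ p) (inj₂ q) with doubles p q
    ... | e , e′ = ⊥-elim (differ _ b b′ e (trans (suc-zero-plus (b - c) a) e′))
    go (inj₂ p) (inj₁ q) with doubles p q
    ... | e , e′ = ⊥-elim (differ _ b′ b e′ (trans (suc-zero-plus (b - c) a) e))

  walk-length : ∀ {s t} → Valid s → Valid t → (w : Walk (place s) (place t)) → dist s t ≤ length w
  walk-length s-valid t-valid w with walk-coords t-valid w
  ... | r , r-valid , eq , r≤ with place-injective r-valid s-valid eq
  ... | refl = r≤

  Closer : Coords → Coords → Set
  Closer s t = ∃[ r ] (Valid r × Adjacent (place s) (place r) × suc (dist r t) ≡ dist s t)

  ↗-closer : ∀ s t {r} → total s ≡ 0ℤ → s ↗ r → suc (dist r t) ≡ dist s t → Closer s t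
  ↗-closer s t s≡0 s↗r eq = _ , inj₂ (↗-total≡1 s↗r s≡0) , ↗-adjacent s≡0 s↗r , eq

  ↙-closer : ∀ s t {r} → total s ≡ 1ℤ → r ↗ s → suc (dist r t) ≡ dist s t → Closer s t
  ↙-closer s t s≡1 r↗s eq = _ , inj₁ r≡0 , symmetric Edge (↗-adjacent r≡0 r↗s) , eq
    where r≡0 = ↗-total≡0 r↗s s≡1

  -- From total 0 a coordinate below its target is raised, from total 1 one above its target is
  -- lowered; the sign of the total difference guarantees that such a coordinate exists unless
  -- `s ≡ t`.
  closer : ∀ s t → Valid s → Valid t → s ≡ t ⊎ Closer s t
  closer s@(a , b , c) t@(a′ , b′ , c′) (inj₁ s≡0) t-valid
    with positive-or-zero (a′ - a) (b′ - b) (c′ - c) (total-nonNeg-from-even s t s≡0 t-valid)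
  ... | inj₁ (_ , eq) = inj₂ (↗-closer s t s≡0 ↗₁ (drop₁ (∣i-suc∣ {a′} {a} eq)))
  ... | inj₂ (inj₁ (_ , eq)) = inj₂ (↗-closer s t s≡0 ↗₂ (drop₂ {∣ a′ - a ∣} (∣i-suc∣ {b′} {b} eq)))
  ... | inj₂ (inj₂ (inj₁ (_ , eq))) =
        inj₂ (↗-closer s t s≡0 ↗₃ (drop₃ {∣ a′ - a ∣} {∣ b′ - b ∣} (∣i-suc∣ {c′} {c} eq)))
  ... | inj₂ (inj₂ (inj₂ (p , q , r))) = inj₁ (sym (⊟-zero p q r))
  closer s@(a , b , c) t@(a′ , b′ , c′) (inj₂ s≡1) t-valid
    with positive-or-zero (a - a′) (b - b′) (c - c′) (total-nonNeg-from-odd s t s≡1 t-valid)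
  ... | inj₁ (_ , eq) = inj₂ (↙-closer s t s≡1 (↙₁ a b c) (drop₁ (∣i-pred∣ {a′} {a} eq)))
  ... | inj₂ (inj₁ (_ , eq)) = inj₂ (↙-closer s t s≡1 (↙₂ a b c) (drop₂ {∣ a′ - a ∣} (∣i-pred∣ {b′} {b} eq)))
  ... | inj₂ (inj₂ (inj₁ (_ , eq))) =
        inj₂ (↙-closer s t s≡1 (↙₃ a b c) (drop₃ {∣ a′ - a ∣} {∣ b′ - b ∣} (∣i-pred∣ {c′} {c} eq)))
  ... | inj₂ (inj₂ (inj₂ (p , q , r))) = inj₁ (⊟-zero p q r)

  shortest-walk : ∀ n s t → Valid s → Valid t → dist s t ≡ n →
                  ∃[ w ] length {place s} {place t} w ≡ n
  shortest-walk n s t s-valid t-valid eq with closer s t s-valid t-valid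
  shortest-walk n s .s s-valid _ eq | inj₁ refl = ε , trans (sym (dist-self s)) eq
  shortest-walk zero s t s-valid t-valid eq | inj₂ (r , _ , _ , r<) = contradiction (trans r< eq) λ ()
  shortest-walk (suc n) s t s-valid t-valid eq | inj₂ (r , r-valid , e , r<)
    with shortest-walk n r t r-valid t-valid (ℕ.suc-injective (trans r< eq))
  ... | w , w≡ = e ◅ w , cong suc w≡

  distance : ∀ {s t} → Valid s → Valid t → d[ place s , place t ]≡ dist s t
  distance s-valid t-valid = shortest-walk _ _ _ s-valid t-valid refl , walk-length s-valid t-valid

-- Positive and negative parts

_⁺ _⁻ : ℤ → ℕ
(+ n)    ⁺ = n
-[1+ n ] ⁺ = 0
(+ n)    ⁻ = 0
-[1+ n ] ⁻ = suc n

posum negsum : Coords → ℕ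
posum (a , b , c) = a ⁺ + b ⁺ + c ⁺
negsum (a , b , c) = a ⁻ + b ⁻ + c ⁻

∣i∣≡ : ∀ i → ∣ i ∣ ≡ i ⁺ + i ⁻
∣i∣≡ (+ n)    = sym (ℕ.+-identityʳ n)
∣i∣≡ -[1+ n ] = refl

i+neg : ∀ i → i ℤ.+ + (i ⁻) ≡ + (i ⁺)
i+neg (+ n)    = ℤ.+-identityʳ (+ n)
i+neg -[1+ n ] = ℤ.n⊖n≡0 (suc n)

norm-split : ∀ t → ∥ t ∥ ≡ posum t + negsum t
norm-split (a , b , c) rewrite ∣i∣≡ a | ∣i∣≡ b | ∣i∣≡ c =
  trans (interleave (a ⁻) (b ⁻) (c ⁻) (a ⁺) (b ⁺) (c ⁺)) (ℕ.+-comm (a ⁻ + b ⁻ + c ⁻) (a ⁺ + b ⁺ + c ⁺))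

total-split : ∀ t → total t ℤ.+ + negsum t ≡ + posum t
total-split (a , b , c) =
  trans (total-plus a b c (+ (a ⁻)) (+ (b ⁻)) (+ (c ⁻))) (cong₂ ℤ._+_ (cong₂ ℤ._+_ (i+neg a) (i+neg b)) (i+neg c))

-- m = ⌈k/2⌉ and n = ⌊k/2⌋ for k = m + n: the sums of the positive and negative parts at distance k.
Balanced : ℕ → ℕ → Set
Balanced m n = m ≡ n ⊎ m ≡ suc n

-- Passing from radius k to k + 1 swaps the roles of the halves: ⌈(k+1)/2⌉ = ⌊k/2⌋ + 1 and ⌊(k+1)/2⌋
-- = ⌈k/2⌉.
balanced-suc : ∀ {m n} → Balanced m n → Balanced (suc n) m
balanced-suc (inj₁ refl) = inj₂ refl
balanced-suc (inj₂ refl) = inj₁ refl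

suc-balanced : ∀ {m n} → Balanced m n → Balanced (suc m) (suc n)
suc-balanced (inj₁ refl) = inj₁ refl
suc-balanced (inj₂ refl) = inj₂ refl

balanced-split : ∀ {k} → 2 ≤ k → ∃[ m ] ∃[ n ] (suc m + suc n ≡ k × Balanced m n)
balanced-split (s≤s (s≤s {n = k} z≤n)) = split k
  where
  split : ∀ k → ∃[ m ] ∃[ n ] (suc m + suc n ≡ 2 + k × Balanced m n)
  split zero = 0 , 0 , refl , inj₁ refl
  split (suc k) with split k
  ... | m , n , eq , bal = suc n , m , cong suc (trans (ℕ.+-comm (suc n) (suc m)) eq) , balanced-suc bal

balanced-half : ∀ {m n} → Balanced m n → n ≡ ⌊ m + n /2⌋
balanced-half {n = n} (inj₁ refl) = ℕ.n≡⌊n+n/2⌋ n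
balanced-half {n = n} (inj₂ refl) = ℕ.n≡⌈n+n/2⌉ n

balanced-unique : ∀ {m n m′ n′} → Balanced m n → Balanced m′ n′ → m + n ≡ m′ + n′ → m ≡ m′ × n ≡ n′
balanced-unique {m} {n} {m′} {n′} bal bal′ eq = ℕ.+-cancelʳ-≡ n m m′ (trans eq (cong (λ z → m′ + z) (sym n≡))) , n≡
  where
  n≡ : n ≡ n′
  n≡ = trans (balanced-half bal) (trans (cong ⌊_/2⌋ eq) (sym (balanced-half bal′)))

-- The total is the positive sum minus the negative sum.
valid⇒balanced : ∀ t → Valid t → Balanced (posum t) (negsum t)
valid⇒balanced t (inj₁ eq) = inj₁ (ℤ.+-injective (trans (sym (total-split t)) (cong (ℤ._+ + negsum t) eq)))
valid⇒balanced t (inj₂ eq) = inj₂ (ℤ.+-injective (trans (sym (total-split t)) (cong (ℤ._+ + negsum t) eq)))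

balanced⇒valid : ∀ t → Balanced (posum t) (negsum t) → Valid t
balanced⇒valid t (inj₁ eq) = inj₁ (+-cancelʳ (+ negsum t) _ _ (trans (total-split t) (cong +_ eq)))
balanced⇒valid t (inj₂ eq) = inj₂ (+-cancelʳ (+ negsum t) _ _ (trans (total-split t) (cong +_ eq)))

-- Enumeration of the spheres

rotate : ∀ {A : Set} → Fin 3 → Triple A → Triple A
rotate 0F (a , b , c) = a , b , c
rotate 1F (a , b , c) = c , a , b
rotate 2F (a , b , c) = b , c , a

rotate-injective : ∀ {A : Set} r {s t : Triple A} → rotate r s ≡ rotate r t → s ≡ t
rotate-injective 0F refl = refl
rotate-injective 1F refl = refl
rotate-injective 2F refl = refl

-- Index α β enumerates the vectors with positive part of sum 1 + α and negative part of sum 1 + β. Up to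
-- rotation they are (A , k - B , - k) for 0 ≤ k < B and (A - k , k , - B) for 0 ≤ k < A, with A = 1 + α
-- and B = 1 + β; the vectors with a zero coordinate are those with k = 0.
Index : ℕ → ℕ → Set
Index α β = Fin 3 × (Fin (suc β) ⊎ Fin (suc α))

side : ∀ α β → Fin (suc β) ⊎ Fin (suc α) → Coords
side α β (inj₁ k) = +[1+ α ] , -[1+ toℕ (opposite k) ] , - (+ toℕ k)
side α β (inj₂ k) = +[1+ toℕ (opposite k) ] , + toℕ k , -[1+ β ]

sphere : ∀ {α β} → Index α β → Coords
sphere (r , s) = rotate r (side _ _ s)

rotate-sum : ∀ r (t : Triple ℕ) → let (a , b , c) = t ; (a′ , b′ , c′) = rotate r t in a′ + b′ + c′ ≡ a + b + c
rotate-sum 0F _ = refl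
rotate-sum 1F (a , b , c) = trans (ℕ.+-assoc c a b) (ℕ.+-comm c (a + b))
rotate-sum 2F (a , b , c) = trans (ℕ.+-comm (b + c) a) (sym (ℕ.+-assoc a b c))

posum-rotate : ∀ r t → posum (rotate r t) ≡ posum t
posum-rotate 0F t = refl
posum-rotate 1F (a , b , c) = rotate-sum 1F (a ⁺ , b ⁺ , c ⁺)
posum-rotate 2F (a , b , c) = rotate-sum 2F (a ⁺ , b ⁺ , c ⁺)

negsum-rotate : ∀ r t → negsum (rotate r t) ≡ negsum t
negsum-rotate 0F t = refl
negsum-rotate 1F (a , b , c) = rotate-sum 1F (a ⁻ , b ⁻ , c ⁻)
negsum-rotate 2F (a , b , c) = rotate-sum 2F (a ⁻ , b ⁻ , c ⁻)

[-+n]⁺ : ∀ n → (- (+ n)) ⁺ ≡ 0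
[-+n]⁺ zero = refl
[-+n]⁺ (suc n) = refl

[-+n]⁻ : ∀ n → (- (+ n)) ⁻ ≡ n
[-+n]⁻ zero = refl
[-+n]⁻ (suc n) = refl

opposite+toℕ : ∀ {n} (k : Fin (suc n)) → toℕ (opposite k) + toℕ k ≡ n
opposite+toℕ {n} k = trans (cong (_+ toℕ k) (Fin.opposite-prop k)) (ℕ.m∸n+n≡m (Fin.toℕ≤pred[n] k))

posum-side : ∀ {α β} s → posum (side α β s) ≡ suc α
posum-side {α} (inj₁ k) rewrite [-+n]⁺ (toℕ k) | ℕ.+-identityʳ α | ℕ.+-identityʳ α = refl
posum-side (inj₂ k) = cong suc (trans (ℕ.+-identityʳ _) (opposite+toℕ k))

negsum-side : ∀ {α β} s → negsum (side α β s) ≡ suc β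
negsum-side (inj₁ k) rewrite [-+n]⁻ (toℕ k) = cong suc (opposite+toℕ k)
negsum-side (inj₂ k) = refl

posum-sphere : ∀ {α β} (i : Index α β) → posum (sphere i) ≡ suc α
posum-sphere (r , s) = trans (posum-rotate r _) (posum-side s)

negsum-sphere : ∀ {α β} (i : Index α β) → negsum (sphere i) ≡ suc β
negsum-sphere (r , s) = trans (negsum-rotate r _) (negsum-side s)

norm-sphere : ∀ {α β} (i : Index α β) → ∥ sphere i ∥ ≡ suc α + suc β
norm-sphere i = trans (norm-split (sphere i)) (cong₂ _+_ (posum-sphere i) (negsum-sphere i))

sphere-valid : ∀ {α β} → Balanced α β → (i : Index α β) → Valid (sphere i)
sphere-valid bal i = balanced⇒valid (sphere i) (subst₂ Balanced (sym (posum-sphere i)) (sym (negsum-sphere i)) (suc-balanced bal))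

from-end : ∀ {m n l} → m + l ≡ n → ∃[ k ] (toℕ {suc n} k ≡ l × toℕ (opposite k) ≡ m)
from-end {m} {n} {l} eq = k , k≡l , ℕ.+-cancelʳ-≡ (toℕ k) _ m
  (trans (opposite+toℕ k) (trans (sym eq) (cong (λ z → m + z) (sym k≡l))))
  where
  l< : l ℕ.< suc n
  l< = s≤s (subst (l ≤_) eq (ℕ.m≤n+m l m))
  k = fromℕ< l<
  k≡l = Fin.toℕ-fromℕ< l<

narrow-side : ∀ {α β m n l} → suc m ≡ suc α → suc n + l ≡ suc β →
              ∃[ s ] side α β s ≡ (+[1+ m ] , -[1+ n ] , - (+ l))
narrow-side {n = n} {l} refl eq with from-end {n} {l = l} (ℕ.suc-injective eq)
... | k , refl , refl = inj₁ k , refl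

wide-side : ∀ {α β m n l} → suc m + l ≡ suc α → suc n ≡ suc β →
            ∃[ s ] side α β s ≡ (+[1+ m ] , + l , -[1+ n ])
wide-side {m = m} {l = l} eq refl with from-end {m} {l = l} (ℕ.suc-injective eq)
... | k , refl , refl = inj₂ k , refl

rotated : ∀ {α β} r {t} → posum (rotate r t) ≡ suc α → negsum (rotate r t) ≡ suc β →
          (posum t ≡ suc α → negsum t ≡ suc β → ∃[ s ] side α β s ≡ t) →
          ∃[ i ] sphere {α} {β} i ≡ rotate r t
rotated r {t} p q f with f (trans (sym (posum-rotate r t)) p) (trans (sym (negsum-rotate r t)) q)
... | s , eq = (r , s) , cong (rotate r) eq

-- The entry `- (+ l)` computes only once `l` is known to be zero or a successor, hence two narrow
-- shapes.
narrow₀-shape : ∀ {α β} m n → let t = (+[1+ m ] , -[1+ n ] , +0) in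
    posum t ≡ suc α → negsum t ≡ suc β → ∃[ s ] side α β s ≡ t
narrow₀-shape m n p q = narrow-side (trans (sym (trans (ℕ.+-identityʳ _) (ℕ.+-identityʳ _))) p) q

narrow₁-shape : ∀ {α β} m n l → let t = (+[1+ m ] , -[1+ n ] , -[1+ l ]) in
    posum t ≡ suc α → negsum t ≡ suc β → ∃[ s ] side α β s ≡ t
narrow₁-shape m n l p q = narrow-side (trans (sym (trans (ℕ.+-identityʳ _) (ℕ.+-identityʳ _))) p) q

wide-shape : ∀ {α β} m l n → let t = (+[1+ m ] , + l , -[1+ n ]) in
    posum t ≡ suc α → negsum t ≡ suc β → ∃[ s ] side α β s ≡ t
wide-shape m l n p q = wide-side (trans (sym (ℕ.+-identityʳ _)) p) q

-- The signs single out the rotation and the kind of side. The patterns left over lack a positive or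
-- a negative entry, so one of the two sums would be zero.
sphere-surjective : ∀ {α β} t → posum t ≡ suc α → negsum t ≡ suc β → ∃[ i ] sphere {α} {β} i ≡ t
sphere-surjective (+[1+ m ] , -[1+ n ] , +0      ) p q = rotated 0F p q (narrow₀-shape m n)
sphere-surjective (+[1+ m ] , -[1+ n ] , -[1+ l ]) p q = rotated 0F p q (narrow₁-shape m n l)
sphere-surjective (+[1+ m ] , + l      , -[1+ n ]) p q = rotated 0F p q (wide-shape m l n)
sphere-surjective (+0       , +[1+ m ] , -[1+ n ]) p q = rotated 1F p q (narrow₀-shape m n)
sphere-surjective (-[1+ l ] , +[1+ m ] , -[1+ n ]) p q = rotated 1F p q (narrow₁-shape m n l)
sphere-surjective (-[1+ n ] , +[1+ m ] , + l     ) p q = rotated 1F p q (wide-shape m l n)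
sphere-surjective (-[1+ n ] , +0       , +[1+ m ]) p q = rotated 2F p q (narrow₀-shape m n)
sphere-surjective (-[1+ n ] , -[1+ l ] , +[1+ m ]) p q = rotated 2F p q (narrow₁-shape m n l)
sphere-surjective (+ l      , -[1+ n ] , +[1+ m ]) p q = rotated 2F p q (wide-shape m l n)
sphere-surjective (+0       , +0       , -[1+ _ ]) ()
sphere-surjective (+0       , -[1+ _ ] , +0      ) ()
sphere-surjective (+0       , -[1+ _ ] , -[1+ _ ]) ()
sphere-surjective (-[1+ _ ] , +0       , +0      ) ()
sphere-surjective (-[1+ _ ] , +0       , -[1+ _ ]) ()
sphere-surjective (-[1+ _ ] , -[1+ _ ] , +0      ) ()
sphere-surjective (-[1+ _ ] , -[1+ _ ] , -[1+ _ ]) ()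
sphere-surjective (+ _      , + _      , + _     ) _ ()

-- Sign patterns and opposition

Sgn : Set
Sgn = Fin 3

pattern neg = 0F
pattern zer = 1F
pattern pos = 2F

sgn : ℤ → Sgn
sgn +[1+ _ ] = pos
sgn +0       = zer
sgn -[1+ _ ] = neg

sgn₃ : Coords → Triple Sgn
sgn₃ (a , b , c) = sgn a , sgn b , sgn c

-- Zero counts as opposed to every sign, itself included: this is exactly the condition for
-- `∣ j - i ∣` to equal `∣ i ∣ + ∣ j ∣`.
opposed : Sgn → Sgn → Bool
opposed neg neg = false
opposed pos pos = false
opposed _   _   = true

opposed₃ : Triple Sgn → Triple Sgn → Bool
opposed₃ (a , b , c) (a′ , b′ , c′) = opposed a a′ ∧ opposed b b′ ∧ opposed c c′

∣suc⊖suc∣≤ : ∀ m n → 2 + ∣ suc m ℤ.⊖ suc n ∣ ≤ suc m + suc n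
∣suc⊖suc∣≤ m n = subst₂ _≤_
  (cong (λ z → 2 + ∣ z ∣) (trans (ℤ.m-n≡m⊖n m n) (sym (ℤ.[1+m]⊖[1+n]≡m⊖n m n))))
  (cong suc (sym (ℕ.+-suc m n)))
  (s≤s (s≤s (ℤ.∣i-j∣≤∣i∣+∣j∣ (+ m) (+ n))))

-- Equal nonzero signs lose twice the smaller absolute value, hence at least 2.
opposed-or-close : ∀ i j → T (opposed (sgn i) (sgn j)) ⊎ 2 + ∣ j - i ∣ ≤ ∣ i ∣ + ∣ j ∣
opposed-or-close +[1+ m ] +[1+ n ] = inj₂ (subst (2 + ∣ suc n ℤ.⊖ suc m ∣ ≤_) (ℕ.+-comm (suc n) (suc m)) (∣suc⊖suc∣≤ n m))
opposed-or-close -[1+ m ] -[1+ n ] = inj₂ (∣suc⊖suc∣≤ m n)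
opposed-or-close +[1+ m ] +0       = inj₁ _
opposed-or-close +[1+ m ] -[1+ n ] = inj₁ _
opposed-or-close +0       +[1+ n ] = inj₁ _
opposed-or-close +0       +0       = inj₁ _
opposed-or-close +0       -[1+ n ] = inj₁ _
opposed-or-close -[1+ m ] +[1+ n ] = inj₁ _
opposed-or-close -[1+ m ] +0       = inj₁ _

∣j-i∣≤ : ∀ i j → ∣ j - i ∣ ≤ ∣ i ∣ + ∣ j ∣
∣j-i∣≤ i j = subst (∣ j - i ∣ ≤_) (ℕ.+-comm ∣ j ∣ ∣ i ∣) (ℤ.∣i-j∣≤∣i∣+∣j∣ j i)

slackˡ : ∀ {a b c d} → d ≤ b → a + b ≤ suc (c + d) → a ≤ suc c
slackˡ {a} {b} {c} d≤b h = ℕ.+-cancelʳ-≤ b a (suc c) (ℕ.≤-trans h (ℕ.+-monoʳ-≤ (suc c) d≤b))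

slackʳ : ∀ {a b c d} → c ≤ a → a + b ≤ suc (c + d) → b ≤ suc d
slackʳ {a} {b} {c} {d} c≤a h = slackˡ c≤a (subst₂ _≤_ (ℕ.+-comm a b) (cong suc (ℕ.+-comm c d)) h)

far-coordinate : ∀ i j → ∣ i ∣ + ∣ j ∣ ≤ suc (∣ j - i ∣) → T (opposed (sgn i) (sgn j))
far-coordinate i j far with opposed-or-close i j
... | inj₁ opp = opp
... | inj₂ close = contradiction (ℕ.≤-trans close far) (ℕ.<-irrefl refl)

-- A single coordinate that is not opposed costs 2, more than the slack of 1. The slack is there for
-- two vertices of the outer sphere.
far⇒opposed : ∀ s t → ∥ s ∥ + ∥ t ∥ ≤ suc (dist s t) → T (opposed₃ (sgn₃ s) (sgn₃ t))
far⇒opposed (a , b , c) (a′ , b′ , c′) far = Equivalence.from T-∧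
  ( far-coordinate a a′ (slackˡ (∣j-i∣≤ b b′) ab)
  , Equivalence.from T-∧
    ( far-coordinate b b′ (slackʳ (∣j-i∣≤ a a′) ab)
    , far-coordinate c c′ (slackʳ (ℕ.+-mono-≤ (∣j-i∣≤ a a′) (∣j-i∣≤ b b′)) abc)))
  where
  abc : (∣ a ∣ + ∣ a′ ∣) + (∣ b ∣ + ∣ b′ ∣) + (∣ c ∣ + ∣ c′ ∣) ≤ suc (∣ a′ - a ∣ + ∣ b′ - b ∣ + ∣ c′ - c ∣)
  abc = ℕ.≤-trans (ℕ.≤-reflexive (trans
    (interleave (∣ a′ ∣) (∣ b′ ∣) (∣ c′ ∣) (∣ a ∣) (∣ b ∣) (∣ c ∣))
    (ℕ.+-comm (∣ a′ ∣ + ∣ b′ ∣ + ∣ c′ ∣) (∣ a ∣ + ∣ b ∣ + ∣ c ∣)))) far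
  ab : (∣ a ∣ + ∣ a′ ∣) + (∣ b ∣ + ∣ b′ ∣) ≤ suc (∣ a′ - a ∣ + ∣ b′ - b ∣)
  ab = slackˡ (∣j-i∣≤ c c′) abc

Code : Set
Code = Fin 3 × Fin 4

-- The four patterns are the signs of the two kinds of side, each with k = 0 and with k > 0.
signs : Code → Triple Sgn
signs (r , k) = rotate r (pattern-of k)
  where
  pattern-of : Fin 4 → Triple Sgn
  pattern-of 0F = pos , neg , zer
  pattern-of 1F = pos , neg , neg
  pattern-of 2F = pos , zer , neg
  pattern-of 3F = pos , pos , neg

kind : ∀ {α β} → Fin (suc β) ⊎ Fin (suc α) → Fin 4
kind (inj₁ zero)    = 0F
kind (inj₁ (suc _)) = 1F
kind (inj₂ zero)    = 2F
kind (inj₂ (suc _)) = 3F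

code : ∀ {α β} → Index α β → Code
code (r , s) = r , kind s

sgn-rotate : ∀ r t → sgn₃ (rotate r t) ≡ rotate r (sgn₃ t)
sgn-rotate 0F t = refl
sgn-rotate 1F t = refl
sgn-rotate 2F t = refl

sgn-sphere : ∀ {α β} (i : Index α β) → sgn₃ (sphere i) ≡ signs (code i)
sgn-sphere (r , s) = trans (sgn-rotate r _) (cong (rotate r) (sgn-side s))
  where
  sgn-side : ∀ {α β} s → sgn₃ (side α β s) ≡ signs (0F , kind s)
  sgn-side (inj₁ zero)    = refl
  sgn-side (inj₁ (suc _)) = refl
  sgn-side (inj₂ zero)    = refl
  sgn-side (inj₂ (suc _)) = refl

Opposed : Code → Code → Set
Opposed c d = T (opposed₃ (signs c) (signs d))

opposed? : ∀ c d → Dec (Opposed c d)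
opposed? c d = T? (opposed₃ (signs c) (signs d))

abstract
  rotation-determined : ∀ r k r′ k′ → signs (r , k) ≡ signs (r′ , k′) → r ≡ r′
  rotation-determined = from-yes (Fin.all? λ r → Fin.all? λ k → Fin.all? λ r′ → Fin.all? λ k′ →
    ≡-dec Fin._≟_ (≡-dec Fin._≟_ Fin._≟_) (signs (r , k)) (signs (r′ , k′)) →-dec (r Fin.≟ r′))

  -- Each coordinate holds at most one `pos` and one `neg`, so at least one `zer`; each pattern has
  -- at most one `zer`, so it has exactly one. The patterns then form a Latin square, whose rows are
  -- rotations of one another. The finite check runs over all codes.
  opposed-triple : ∀ r k r′ k′ r″ k″ →
    Opposed (r , k) (r′ , k′) → Opposed (r , k) (r″ , k″) → Opposed (r′ , k′) (r″ , k″) →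
    (k ≡ 0F × k′ ≡ 0F) ⊎ (k ≡ 2F × k′ ≡ 2F)
  opposed-triple = from-yes (Fin.all? λ r → Fin.all? λ k → Fin.all? λ r′ → Fin.all? λ k′ → Fin.all? λ r″ → Fin.all? λ k″ →
    opposed? (r , k) (r′ , k′) →-dec (opposed? (r , k) (r″ , k″) →-dec (opposed? (r′ , k′) (r″ , k″) →-dec
      ((k Fin.≟ 0F ×-dec k′ Fin.≟ 0F) ⊎-dec (k Fin.≟ 2F ×-dec k′ Fin.≟ 2F)))))

  -- In each coordinate the three rotations show all three signs, so any nonzero coordinate of the
  -- other pattern clashes with one of them.
  not-opposed-to-triangle : ∀ k r″ k″ → k ≡ 0F ⊎ k ≡ 2F →
    ¬ (Opposed (0F , k) (r″ , k″) × Opposed (1F , k) (r″ , k″) × Opposed (2F , k) (r″ , k″))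
  not-opposed-to-triangle = from-yes (Fin.all? λ k → Fin.all? λ r → Fin.all? λ k′ →
    (k Fin.≟ 0F ⊎-dec k Fin.≟ 2F) →-dec ¬? (opposed? (0F , k) (r , k′) ×-dec (opposed? (1F , k) (r , k′) ×-dec opposed? (2F , k) (r , k′))))

-- The signs fix the rotation; afterwards the entry that is `toℕ k` up to sign recovers `k`.
sphere-injective : ∀ {α β} {i j : Index α β} → sphere i ≡ sphere j → i ≡ j
sphere-injective {i = r , s} {j = r′ , s′} eq
  with rotation-determined r (kind s) r′ (kind s′)
         (trans (sym (sgn-sphere (r , s))) (trans (cong sgn₃ eq) (sgn-sphere (r′ , s′))))
... | refl = cong (r ,_) (side-injective s s′ (rotate-injective r eq))
  where
  side-injective : ∀ {α β} s s′ → side α β s ≡ side α β s′ → s ≡ s′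
  side-injective (inj₁ k) (inj₁ k′) eq =
    cong inj₁ (Fin.toℕ-injective (ℤ.+-injective (ℤ.neg-injective (cong (proj₂ ∘ proj₂) eq))))
  side-injective (inj₂ k) (inj₂ k′) eq =
    cong inj₂ (Fin.toℕ-injective (ℤ.+-injective (cong (proj₁ ∘ proj₂) eq)))

-- The six vectors with a zero coordinate; the Boolean chooses the rotation orbit.
corner : ∀ {α β} → Bool → Fin 3 → Index α β
corner false r = r , inj₁ zero
corner true  r = r , inj₂ zero

kind-corner : ∀ {α β} r s → (kind {α} {β} s ≡ 0F → (r , s) ≡ corner {α} {β} false r) × (kind s ≡ 2F → (r , s) ≡ corner true r)
kind-corner r (inj₁ zero)    = (λ _ → refl) , λ ()
kind-corner r (inj₁ (suc _)) = (λ ()) , λ ()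
kind-corner r (inj₂ zero)    = (λ ()) , λ _ → refl
kind-corner r (inj₂ (suc _)) = (λ ()) , λ ()

collision-corner : ∀ {α β α′ β′} (i j : Index α β) (k : Index α′ β′) →
  Opposed (code i) (code j) → Opposed (code i) (code k) → Opposed (code j) (code k) →
  ∃[ b ] ∃[ r ] ∃[ r′ ] (i ≡ corner b r × j ≡ corner b r′)
collision-corner (r , s) (r′ , s′) (r″ , s″) ij ik jk
  with opposed-triple r (kind s) r′ (kind s′) r″ (kind s″) ij ik jk
... | inj₁ (p , q) = false , r , r′ , proj₁ (kind-corner r s) p , proj₁ (kind-corner r′ s′) q
... | inj₂ (p , q) = true , r , r′ , proj₂ (kind-corner r s) p , proj₂ (kind-corner r′ s′) q

-- Counting with exceptions

-- Sending `x` and `y` to two fresh values turns `φ` into an injection.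
injective-except-two : ∀ {m n} (φ : Fin m → Fin n) x y →
  (∀ i j → i ≢ j → φ i ≡ φ j → (i ≡ x ⊎ i ≡ y) ⊎ (j ≡ x ⊎ j ≡ y)) → m ≤ 2 + n
injective-except-two {m} {n} φ x y inj = Fin.injective⇒≤ (λ {i} {j} → ψ-injective i j)
  where
  ψ : Fin m → Fin (2 + n)
  ψ i with i Fin.≟ x | i Fin.≟ y
  ... | yes _ | _     = zero
  ... | no _  | yes _ = suc zero
  ... | no _  | no _  = suc (suc (φ i))
  ψ-injective : ∀ i j → ψ i ≡ ψ j → i ≡ j
  ψ-injective i j eq with i Fin.≟ x | i Fin.≟ y | j Fin.≟ x | j Fin.≟ y
  ... | yes p | _     | yes q | _     = trans p (sym q)
  ... | no _  | yes p | no _  | yes q = trans p (sym q)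
  ψ-injective i j () | yes _ | _     | no _  | yes _
  ψ-injective i j () | yes _ | _     | no _  | no _
  ψ-injective i j () | no _  | yes _ | yes _ | _
  ψ-injective i j () | no _  | yes _ | no _  | no _
  ψ-injective i j () | no _  | no _  | yes _ | _
  ψ-injective i j () | no _  | no _  | no _  | yes _
  ψ-injective i j eq | no p  | no q  | no r  | no t with i Fin.≟ j
  ... | yes i≡j = i≡j
  ... | no i≢j with inj i j i≢j (Fin.suc-injective (Fin.suc-injective eq))
  ...   | inj₁ (inj₁ e) = contradiction e p
  ...   | inj₁ (inj₂ e) = contradiction e q
  ...   | inj₂ (inj₁ e) = contradiction e r
  ...   | inj₂ (inj₂ e) = contradiction e t

-- At most one pair among the three values coincides, and `e` is a member of that pair.
exception : ∀ {n} (g : Fin 3 → Fin n) → ¬ (g 0F ≡ g 1F × g 0F ≡ g 2F) →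
            ∃[ e ] (∀ r r′ → g r ≡ g r′ → r ≡ r′ ⊎ r ≡ e ⊎ r′ ≡ e)
exception g ¬const with g 0F Fin.≟ g 1F | g 0F Fin.≟ g 2F
... | yes p | yes q = contradiction (p , q) ¬const
... | yes p | no q = 0F , λ where
  0F _ _ → inj₂ (inj₁ refl)
  _ 0F _ → inj₂ (inj₂ refl)
  1F 1F _ → inj₁ refl
  2F 2F _ → inj₁ refl
  1F 2F e → contradiction (trans p e) q
  2F 1F e → contradiction (trans p (sym e)) q
... | no p | yes q = 0F , λ where
  0F _ _ → inj₂ (inj₁ refl)
  _ 0F _ → inj₂ (inj₂ refl)
  1F 1F _ → inj₁ refl
  2F 2F _ → inj₁ refl
  1F 2F e → contradiction (trans q (sym e)) p
  2F 1F e → contradiction (trans q e) p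
... | no p | no q = 1F , λ where
  1F _ _ → inj₂ (inj₁ refl)
  _ 1F _ → inj₂ (inj₂ refl)
  0F 0F _ → inj₁ refl
  2F 2F _ → inj₁ refl
  0F 2F e → contradiction e q
  2F 0F e → contradiction (sym e) q

index↔ : ∀ {α β} → Fin (3 * (suc β + suc α)) ↔ Index α β
index↔ = (↔-id _ ×-↔ Fin.+↔⊎) ↔-∘ Fin.*↔×

to-codes : ∀ {α β α′ β′} (i : Index α β) (j : Index α′ β′) →
           T (opposed₃ (sgn₃ (sphere i)) (sgn₃ (sphere j))) → Opposed (code i) (code j)
to-codes i j = subst₂ (λ a b → T (opposed₃ a b)) (sgn-sphere i) (sgn-sphere j)

-- Colors on the inner and outer spheres

module Colored {α β : ℕ} (bal : Balanced α β) (x : Vertex) (x-right : Right x)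
  {n : ℕ} (f : Vertex → Fin n) (f-coloring : IsDistanceColoring (2 * (suc α + suc β)) f) where

  open Embedding x x-right

  p : ℕ
  p = suc α + suc β

  -- Radius `p` and radius `p + 1`; the parameters of `Outer` are swapped as in `balanced-suc`.
  Inner Outer : Set
  Inner = Index α β
  Outer = Index (suc β) α

  inner-valid : (j : Inner) → Valid (sphere j)
  inner-valid = sphere-valid bal

  outer-valid : (i : Outer) → Valid (sphere i)
  outer-valid = sphere-valid (balanced-suc bal)

  color : Coords → Fin n
  color = f ∘ place

  same-color⇒far : ∀ {s t} → Valid s → Valid t → s ≢ t → color s ≡ color t → suc (2 * p) ≤ dist s t
  same-color⇒far s-valid t-valid s≢t eq = ℕ.≰⇒> λ near →
    f-coloring _ _ (s≢t ∘ place-injective s-valid t-valid) (_ , distance s-valid t-valid , near) eq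

  outer≰ : ∀ (i : Outer) → ¬ ∥ sphere i ∥ ≤ p
  outer≰ i le = ℕ.<-irrefl refl (subst (_≤ p) (trans (norm-sphere i) (trans (outer-radius α β) (ℕ.+-comm p 1))) le)

  place-origin : place origin ≡ x
  place-origin = cong₂ _,_ (ℤ.+-identityʳ x₁) (ℤ.+-identityʳ x₂)

  outer∈𝓕 : (i : Outer) → place (sphere i) ∈ 𝓕 x (p + 1)
  outer∈𝓕 i = subst₂ (λ y k → d[ y , place (sphere i) ]≡ k) place-origin
    (trans (dist-origin (sphere i)) (trans (norm-sphere i) (outer-radius α β)))
    (distance {origin} {sphere i} (inj₁ refl) (outer-valid i))

  ball-coords : ∀ {w} → w ∈ V (D^2 p x) → ∃[ t ] (Valid t × place t ≡ w × ∥ t ∥ ≤ p)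
  ball-coords {w} w∈ with subst (λ y → d[ w , y ]≤ p) (sym place-origin) w∈
  ... | k , ((walk , refl) , _) , k≤p with walk-coords {t = origin} (inj₁ refl) walk
  ... | t , t-valid , eq , t≤k = t , t-valid , eq ,
        ℕ.≤-trans (ℕ.≤-reflexive (trans (sym (dist-origin t)) (dist-sym origin t))) (ℕ.≤-trans t≤k k≤p)

  -- A ball vertex with the color of `sphere i` is at distance at least 2p + 1 from it, while
  -- `sphere i` has norm p + 1; so that vertex has norm exactly p and occurs in `Inner`.
  color-avoiding⇒∉image : (i : Outer) → (∀ (j : Inner) → color (sphere i) ≢ color (sphere j)) →
                          color (sphere i) ∉ image f (V (D^2 p x))
  color-avoiding⇒∉image i avoids (w , w∈ , eq) with ball-coords w∈
  ... | t , t-valid , refl , t≤p = avoids j (trans (sym eq) (cong color (sym sphere≡t)))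
    where
    far : suc (2 * p) ≤ ∥ sphere i ∥ + ∥ t ∥
    far = ℕ.≤-trans
      (same-color⇒far (outer-valid i) t-valid (λ i≡t → outer≰ i (subst (λ s → ∥ s ∥ ≤ p) (sym i≡t) t≤p)) (sym eq))
      (dist≤∥∥+∥∥ (sphere i) t)
    p≤t : p ≤ ∥ t ∥
    p≤t = ℕ.+-cancelˡ-≤ (suc (suc β) + suc α) _ _
      (subst₂ _≤_ (sym (outer+inner α β)) (cong (_+ ∥ t ∥) (norm-sphere i)) far)
    sums : posum t ≡ suc α × negsum t ≡ suc β
    sums = balanced-unique (valid⇒balanced t t-valid) (suc-balanced bal)
      (trans (sym (norm-split t)) (ℕ.≤-antisym t≤p p≤t))
    on-sphere = sphere-surjective t (proj₁ sums) (proj₂ sums)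
    j = proj₁ on-sphere
    sphere≡t = proj₂ on-sphere

  -- The norms add up to 2p + 1, which the distance must reach.
  outer-inner-opposed : (i : Outer) (j : Inner) → color (sphere i) ≡ color (sphere j) → Opposed (code i) (code j)
  outer-inner-opposed i j eq = to-codes i j (far⇒opposed (sphere i) (sphere j) (ℕ.m≤n⇒m≤1+n
    (subst (_≤ dist (sphere i) (sphere j)) (sym (trans (cong₂ _+_ (norm-sphere i) (norm-sphere j)) (outer+inner α β)))
      (same-color⇒far (outer-valid i) (inner-valid j)
        (λ i≡j → outer≰ i (ℕ.≤-reflexive (trans (cong ∥_∥ i≡j) (norm-sphere j)))) eq))))

  -- The norms add up to 2p + 2 and the distance is at least 2p + 1, which uses the slack of
  -- `far⇒opposed`.
  outer-outer-opposed : (i j : Outer) → i ≢ j → color (sphere i) ≡ color (sphere j) → Opposed (code i) (code j)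
  outer-outer-opposed i j i≢j eq = to-codes i j (far⇒opposed (sphere i) (sphere j)
    (subst (_≤ suc (dist (sphere i) (sphere j))) (sym (trans (cong₂ _+_ (norm-sphere i) (norm-sphere j)) (outer+outer α β)))
      (s≤s (same-color⇒far (outer-valid i) (outer-valid j) (i≢j ∘ sphere-injective) eq))))

  -- The assumption to be refuted: every color of the outer sphere recurs on the inner one.
  module _ (match : (i : Outer) → ∃[ j ] color (sphere i) ≡ color (sphere {α} {β} j)) where

    partner : Outer → Inner
    partner i = proj₁ (match i)

    -- A partner of one corner would have the color of all three and be opposed to the whole orbit.
    corners-not-constant : ∀ b → let g = λ r → color (sphere {suc β} {α} (corner b r)) in ¬ (g 0F ≡ g 1F × g 0F ≡ g 2F)
    corners-not-constant b (p , q) with match (corner b 0F)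
    ... | j , eq with outer-inner-opposed (corner b 0F) j eq
                    | outer-inner-opposed (corner b 1F) j (trans (sym p) eq)
                    | outer-inner-opposed (corner b 2F) j (trans (sym q) eq)
    corners-not-constant false _ | (r , s) , _ | o₀ | o₁ | o₂ = not-opposed-to-triangle 0F r (kind s) (inj₁ refl) (o₀ , o₁ , o₂)
    corners-not-constant true _ | (r , s) , _ | o₀ | o₁ | o₂ = not-opposed-to-triangle 2F r (kind s) (inj₂ refl) (o₀ , o₁ , o₂)

    repeated : ∀ b → ∃[ e ] (∀ r r′ → color (sphere {suc β} {α} (corner b r)) ≡ color (sphere {suc β} {α} (corner b r′)) →
                             r ≡ r′ ⊎ r ≡ e ⊎ r′ ≡ e)
    repeated b = exception _ (corners-not-constant b)

    dropped : Bool → Outer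
    dropped b = corner b (proj₁ (repeated b))

    Dropped : Outer → Set
    Dropped i = i ≡ dropped false ⊎ i ≡ dropped true

    dropped-is : ∀ b → Dropped (dropped b)
    dropped-is false = inj₁ refl
    dropped-is true  = inj₂ refl

    -- Equal partners force equal colors, so `i`, `j` and the partner are pairwise opposed. Then `i`
    -- and `j` are corners of one orbit, where `repeated` applies.
    collision : ∀ i j → i ≢ j → partner i ≡ partner j → Dropped i ⊎ Dropped j
    collision i j i≢j eq with match i | match j
    collision i j i≢j refl | k , i~k | .k , j~k
      with collision-corner i j k (outer-outer-opposed i j i≢j (trans i~k (sym j~k)))
                                  (outer-inner-opposed i k i~k) (outer-inner-opposed j k j~k)
    ... | b , r , r′ , refl , refl with proj₂ (repeated b) r r′ (trans i~k (sym j~k))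
    ... | inj₁ refl        = contradiction refl i≢j
    ... | inj₂ (inj₁ refl) = inj₁ (dropped-is b)
    ... | inj₂ (inj₂ refl) = inj₂ (dropped-is b)

  module O = Inverse (index↔ {suc β} {α})
  module I = Inverse (index↔ {α} {β})

  -- With two exceptions, `partner` injects 3(p + 1) indices into 3p, giving 3p + 3 ≤ 3p + 2.
  ¬match : ¬ ((i : Outer) → ∃[ j ] color (sphere i) ≡ color (sphere {α} {β} j))
  ¬match match = ℕ.<-irrefl refl (subst (_≤ 2 + 3 * (suc β + suc α)) (sphere-sizes α β)
    (injective-except-two (I.from ∘ partner match ∘ O.to) (O.from (dropped match false)) (O.from (dropped match true)) inj))
    where
    from-O : ∀ {i k} → O.to i ≡ k → i ≡ O.from k
    from-O {i} eq = trans (sym (O.strictlyInverseʳ i)) (cong O.from eq)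

    is-dropped : ∀ {i} → Dropped match (O.to i) → i ≡ O.from (dropped match false) ⊎ i ≡ O.from (dropped match true)
    is-dropped = Sum.map from-O from-O

    inj : ∀ i j → i ≢ j → I.from (partner match (O.to i)) ≡ I.from (partner match (O.to j)) →
          (i ≡ O.from (dropped match false) ⊎ i ≡ O.from (dropped match true)) ⊎
          (j ≡ O.from (dropped match false) ⊎ j ≡ O.from (dropped match true))
    inj i j i≢j eq = Sum.map is-dropped is-dropped (collision match (O.to i) (O.to j)
      (λ e → i≢j (trans (from-O e) (O.strictlyInverseʳ j)))
      (trans (sym (I.strictlyInverseˡ _)) (trans (cong I.to eq) (I.strictlyInverseˡ _))))

  result : ∃[ u ] (u ∈ 𝓕 x (p + 1) × f u ∉ image f (V (D^2 p x)))
  -- Both spheres are finite and colors are decidable, so a search either finds the vertex or yields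
  -- `match`.
  result with Fin.any? (λ i → Fin.all? (λ j → ¬? (color (sphere (O.to i)) Fin.≟ color (sphere (I.to j)))))
  ... | yes (i , avoids) = place (sphere (O.to i)) , outer∈𝓕 (O.to i) , color-avoiding⇒∉image (O.to i)
        λ j → subst (λ j → color (sphere (O.to i)) ≢ color (sphere j)) (I.strictlyInverseˡ j) (avoids (I.from j))
  ... | no ¬avoids = ⊥-elim (¬match match)
    where
    match : (i : Outer) → ∃[ j ] color (sphere i) ≡ color (sphere {α} {β} j)
    match i with Fin.any? (λ j → color (sphere i) Fin.≟ color (sphere (I.to j)))
    ... | yes (j , eq) = I.to j , eq
    ... | no ¬any = contradiction
          (O.from i , λ j → subst (λ i → color (sphere i) ≢ _) (sym (O.strictlyInverseˡ i)) (λ eq → ¬any (j , eq)))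
          ¬avoids

theorem1 : ∀ (p : ℕ) → 3 ≤ p →
    ∀ (x : Vertex) → Right x →
    ∀ (n : ℕ) (f : Vertex → Fin n) → IsDistanceColoring (2 * p) f →
    ∃[ u ] (u ∈ 𝓕 x (p + 1) × f u ∉ image f (V (D^2 p x)))
theorem1 p 3≤p x x-right n f f-coloring with balanced-split (ℕ.<⇒≤ 3≤p)
-- Here `p` becomes `suc α + suc β`; positive halves give every vertex of both spheres a positive
-- and a negative coordinate.
... | α , β , refl , bal = Colored.result bal x x-right f f-coloring
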